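{- Let $n\ge 6$ and let $G\in B^{+}_n$. (1) $\mathrm{irr}_t(G)\ge 2n-2$. Equality holds if and only if the degree sequence of $G$ is $(4,2,\ldots,2)$, i.e. one vertex of degree $4$ and $n-1$ vertices of degree $2$. (2) If the degree sequence of $G$ is not $(4,2,\ldots,2)$, then $\mathrm{irr}_t(G)\ge 4n-6$. Equality holds if and only if the degree sequence of $G$ is $(4,3,2,\ldots,2,1)$, i.e. one vertex of degree $4$, one of degree $3$, $n-3$ of degree $2$ and one of degree $1$.
   Context: A bicyclic graph is a simple connected graph whose number of edges equals its number of vertices plus one. For a graph $G=(V,E)$ and $w\in V$, $d_G(w)$ is the degree of $w$. The total irregularity is $\mathrm{irr}_t(G)=\frac12\sum_{x,y\in V}|d_G(x)-d_G(y)|$, where the sum runs over all ordered pairs of vertices. Degree sequences are listed in nonincreasing order. For $p,q\ge 3$ and $l\ge 1$, the $\infty$-graph $\infty(p,q,l)$ is obtained from two vertex-disjoint cycles $C_p$ and $C_q$ by joining a vertex of $C_p$ and a vertex of $C_q$ with a path having $l$ vertices (i.e. length $l-1$). When $l=1$ the two vertices are identified, so the cycles share exactly one vertex. $B^{+}_n$ denotes the set of bicyclic graphs on $n$ vertices obtained from some $\infty(p,q,1)$ by attaching trees. Equivalently, these are the bicyclic graphs on $n$ vertices whose two cycles share exactly one vertex. -}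

module Defs where

import Algebra.Properties.Semiring.Sum as SemiringSum
open import Data.Fin.Base using (Fin; zero; suc; toℕ)
open import Data.Fin.Properties using (_<?_)
open import Data.List.Base using (List; length; filter; allFin; tabulate; cartesianProduct)
open import Data.Nat.Base using (ℕ; zero; suc; _+_; _*_; _≥_; ∣_-_∣)
open import Data.Nat.Divisibility using (_∣_; divides)
open import Data.Nat.DivMod using (_/_; m*[n/m]≡n)
open import Data.Nat.Properties
  using (+-*-semiring; ≤-decTotalOrder; ∣-∣-comm; ∣n-n∣≡0)
import Data.Nat.Tactic.RingSolver as ℕ-Solver
import Data.List.Sort
open import Data.Product using (Σ-syntax; _×_; _,_; ∃; ∃!; proj₁; proj₂)
open import Data.Sum.Base using (_⊎_)
open import Function.Definitions using (Injective)
open import Level using (0ℓ)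
open import Relation.Binary.Construct.Closure.ReflexiveTransitive using (Star)
open import Relation.Binary.Core using (Rel)
open import Relation.Binary.Definitions using (Decidable; Symmetric; Irreflexive)
open import Relation.Binary.Properties.DecTotalOrder ≤-decTotalOrder using (≥-decTotalOrder)
open import Relation.Binary.PropositionalEquality using (_≡_; refl; cong; cong₂; module ≡-Reasoning)
open import Relation.Nullary.Decidable using (_×-dec_)

open SemiringSum +-*-semiring using (sum-syntax; sum-cong-≗; ∑-distrib-+)
open Data.List.Sort ≥-decTotalOrder using (sort)

record Graph (n : ℕ) : Set₁ where
  field
    Adj    : Rel (Fin n) 0ℓ
    adj?   : Decidable Adj
    symm   : Symmetric Adj
    irrefl : Irreflexive _≡_ Adj

module _ {n : ℕ} (G : Graph n) where
  open Graph G

  degree : Fin n → ℕ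
  degree v = length (filter (adj? v) (allFin n))

  -- Each edge is represented once, by its pair of endpoints in increasing order.
  edges : List (Fin n × Fin n)
  edges = filter (λ e → (proj₁ e <? proj₂ e) ×-dec adj? (proj₁ e) (proj₂ e))
                 (cartesianProduct (allFin n) (allFin n))

  Connected : Set
  Connected = ∀ x y → Star Adj x y

  Bicyclic : Set
  Bicyclic = Connected × length edges ≡ n + 1

  -- Sorting with respect to _≥_ gives the nonincreasing order.
  degreeSequence : List ℕ
  degreeSequence = sort (tabulate degree)

  irrSum : ℕ
  irrSum = ∑[ x < n ] ∑[ y < n ] ∣ degree x - degree y ∣

  -- The division is exact: see 2*irrₜ≡irrSum below.
  irrₜ : ℕ
  irrₜ = irrSum / 2

-- j is the successor of i in the cyclic order 0, 1, …, k - 1, 0.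
CyclicSucc : ∀ {k} → Rel (Fin k) 0ℓ
CyclicSucc {k} i j = toℕ j ≡ suc (toℕ i) ⊎ (suc (toℕ i) ≡ k × toℕ j ≡ 0)

record Cycle {n : ℕ} (G : Graph n) : Set where
  open Graph G
  field
    size      : ℕ
    size≥3    : size ≥ 3
    vertex    : Fin size → Fin n
    injective : Injective _≡_ _≡_ vertex
    adjacent  : ∀ {i j} → CyclicSucc i j → Adj (vertex i) (vertex j)

_∈ᶜ_ : ∀ {n} {G : Graph n} → Fin n → Cycle G → Set
v ∈ᶜ C = ∃ λ i → Cycle.vertex C i ≡ v

-- Two cycles with exactly one common vertex form an ∞(p,q,1).  If G is
-- bicyclic, the rest of G then consists of trees attached to it, so that
-- C and D are the only cycles of G.
B⁺ : ∀ {n} → Graph n → Set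
B⁺ G = Bicyclic G ×
       Σ[ C ∈ Cycle G ] Σ[ D ∈ Cycle G ] ∃! _≡_ (λ v → v ∈ᶜ C × v ∈ᶜ D)

2∣symmetric-∑ : ∀ n (f : Fin n → Fin n → ℕ) →
                (∀ x y → f x y ≡ f y x) → (∀ x → f x x ≡ 0) →
                2 ∣ (∑[ x < n ] ∑[ y < n ] f x y)
2∣symmetric-∑ zero    f f-sym f-diag = divides 0 refl
2∣symmetric-∑ (suc n) f f-sym f-diag
  with divides q eq ← 2∣symmetric-∑ n (λ x y → f (suc x) (suc y))
                        (λ x y → f-sym (suc x) (suc y)) (λ x → f-diag (suc x))
  = divides (a + q) (begin
      (f zero zero + a) + (∑[ x < n ] (f (suc x) zero + ∑[ y < n ] f (suc x) (suc y)))
        ≡⟨ cong₂ _+_ (cong (_+ a) (f-diag zero))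
             (∑-distrib-+ (λ x → f (suc x) zero) (λ x → ∑[ y < n ] f (suc x) (suc y))) ⟩
      a + ((∑[ x < n ] f (suc x) zero) + (∑[ x < n ] ∑[ y < n ] f (suc x) (suc y)))
        ≡⟨ cong (a +_) (cong₂ _+_ (sum-cong-≗ (λ x → f-sym (suc x) zero)) eq) ⟩
      a + (a + q * 2)
        ≡⟨ double a q ⟩
      (a + q) * 2 ∎)
  where
  open ≡-Reasoning
  a : ℕ
  a = ∑[ y < n ] f zero (suc y)
  double : ∀ a q → a + (a + q * 2) ≡ (a + q) * 2
  double = ℕ-Solver.solve-∀

2*irrₜ≡irrSum : ∀ {n} (G : Graph n) → 2 * irrₜ G ≡ irrSum G
2*irrₜ≡irrSum {n} G = m*[n/m]≡n
  (2∣symmetric-∑ n (λ x y → ∣ degree G x - degree G y ∣)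
    (λ x y → ∣-∣-comm (degree G x) (degree G y)) (λ x → ∣n-n∣≡0 (degree G x)))

{-# OPTIONS --safe #-}

-- Only the list of degrees matters: it has length n and sum 2n + 2, all its
-- entries are positive, and the common vertex of the two cycles has degree at
-- least 4.  Removing the maximum a of a list lowers the total irregularity by
-- k a - s, where k is the length and s the sum of the rest.  Removing a 4 leaves
-- a list of average 2, so either the constant list or one with maximum at
-- least 3; removing a 3 from the latter leaves a list whose sum is one less
-- than twice its length, which has least irregularity when it is (2,…,2,1).
-- Every larger maximum exceeds the claimed bounds strictly.
module Submission where

open import Defs
import Algebra.Properties.Semiring.Sum as SemiringSum
open import Data.Bool.Base using (if_then_else_)
open import Data.Fin.Base as Fin using (Fin; zero; suc; toℕ; fromℕ<)
open import Data.Fin.Properties using (<-asym; <-cmp; _<?_; injective⇒≤; toℕ-fromℕ<; toℕ<n)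
open import Data.List.Base
  using (List; _∷_; []; _++_; replicate; length; map; filter; lookup; tabulate; allFin; cartesianProduct)
open import Data.List.Membership.Propositional.Properties using (∈-allFin; ∈-filter⁺)
open import Data.List.Properties using (++-identityʳ; length-++; filter-++; map-tabulate; length-tabulate)
open import Data.List.Relation.Binary.Permutation.Propositional
  using (_↭_; ↭-sym; prep; swap) renaming (refl to ↭-refl; trans to ↭-trans)
open import Data.List.Relation.Binary.Permutation.Propositional.Properties
  using (map⁺; All-resp-↭; Any-resp-↭; ↭-length)
open import Data.List.Relation.Unary.All as All using (All; []; _∷_)
import Data.List.Relation.Unary.All.Properties as All
open import Data.List.Relation.Unary.AllPairs using (AllPairs; []; _∷_)
open import Data.List.Relation.Unary.Any as Any using (Any; here; there)
import Data.List.Relation.Unary.Any.Properties as Any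
open import Data.List.Relation.Unary.Linked.Properties using (Linked⇒AllPairs)
import Data.List.Sort
open import Data.Nat.Base
open import Data.Nat.ListAction using (sum)
open import Data.Nat.ListAction.Properties using (sum-↭)
open import Data.Nat.Properties hiding (<-asym; <-cmp; _<?_)
open import Data.Nat.Tactic.RingSolver using (solve-∀)
open import Data.Product.Base using (_×_; _,_; ∃; proj₁; proj₂)
open import Data.Sum.Base using (_⊎_; inj₁; inj₂)
open import Function.Base using (_∘_; id)
open import Function.Bundles using (_⇔_; mk⇔)
open import Function.Definitions using (Injective)
open import Relation.Binary.Construct.Closure.ReflexiveTransitive using (ε; _◅_)
open import Relation.Binary.Definitions using (tri<; tri≈; tri>)
open import Relation.Binary.Properties.DecTotalOrder ≤-decTotalOrder using (≥-decTotalOrder)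
open import Relation.Binary.PropositionalEquality
open import Relation.Nullary using (¬_; Dec; yes; no; does; contradiction)
open import Relation.Nullary.Decidable using (_×-dec_)
open import Relation.Unary using (Decidable)

open SemiringSum +-*-semiring using (sum-syntax; sum-cong-≗; ∑-distrib-+; ∑-comm)
open Data.List.Sort ≥-decTotalOrder using (sort-↭; sort-↗)

-- Irregularity of a list of numbers.

distances : ℕ → List ℕ → ℕ
distances a xs = sum (map (λ x → ∣ a - x ∣) xs)

-- Each unordered pair of positions counts once, so the sum over ordered pairs is already halved.
irregularity : List ℕ → ℕ
irregularity []       = 0
irregularity (x ∷ xs) = distances x xs + irregularity xs

-- Allows passing from degrees in vertex order to the sorted sequence. Only a swap needs an
-- argument: the distance of the two heads is symmetric, and the other distances are regrouped.
irregularity-↭ : ∀ {xs ys} → xs ↭ ys → irregularity xs ≡ irregularity ys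
irregularity-↭ ↭-refl        = refl
irregularity-↭ (prep x p)    = cong₂ _+_ (sum-↭ (map⁺ _ p)) (irregularity-↭ p)
irregularity-↭ (↭-trans p q) = trans (irregularity-↭ p) (irregularity-↭ q)
irregularity-↭ {_ ∷ _ ∷ xs} {_ ∷ _ ∷ ys} (swap x y p) = begin
  ∣ x - y ∣ + distances x xs + (distances y xs + irregularity xs)
    ≡⟨ cong₂ _+_ (cong₂ _+_ (∣-∣-comm x y) (sum-↭ (map⁺ _ p)))
         (cong₂ _+_ (sum-↭ (map⁺ _ p)) (irregularity-↭ p)) ⟩
  ∣ y - x ∣ + distances x ys + (distances y ys + irregularity ys)
    ≡⟨ exchange ∣ y - x ∣ (distances x ys) (distances y ys) (irregularity ys) ⟩
  ∣ y - x ∣ + distances y ys + (distances x ys + irregularity ys) ∎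
  where
  open ≡-Reasoning
  exchange : ∀ d a b c → d + a + (b + c) ≡ d + b + (a + c)
  exchange = solve-∀

-- For `x ≤ a`, `∣ a - x ∣ + x ≡ a`; the additive form avoids truncated subtraction.
distances-max : ∀ {a xs} → All (_≤ a) xs → distances a xs + sum xs ≡ length xs * a
distances-max {a} {[]}     []       = refl
distances-max {a} {x ∷ xs} (p ∷ ps) = begin
  ∣ a - x ∣ + distances a xs + (x + sum xs)
    ≡⟨ exchange ∣ a - x ∣ (distances a xs) x (sum xs) ⟩
  ∣ a - x ∣ + x + (distances a xs + sum xs)
    ≡⟨ cong₂ _+_ (trans (cong (_+ x) (m≤n⇒∣n-m∣≡n∸m p)) (m∸n+n≡m p)) (distances-max ps) ⟩
  a + length xs * a ∎
  where
  open ≡-Reasoning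
  exchange : ∀ d a b c → d + a + (b + c) ≡ d + b + (a + c)
  exchange = solve-∀

-- The maximum is written 2 + e and the sum relative to twice the length, so
-- that the sum of xs disappears.
irregularity-peel : ∀ {k e r xs} → length xs ≡ k → All (_≤ 2 + e) xs →
                    2 + e + sum xs ≡ 2 * k + r →
                    irregularity (2 + e ∷ xs) + r ≡ k * e + (2 + e) + irregularity xs
-- With `2 * k` added to both sides, `total` trades `2 * k + r` for the sum of the whole list.
irregularity-peel {k} {e} {r} {xs} refl max total = +-cancelˡ-≡ (2 * k) _ _ (begin
  2 * k + (distances (2 + e) xs + T + r)    ≡⟨ assemble k (distances (2 + e) xs) T r ⟩
  distances (2 + e) xs + T + (2 * k + r)    ≡⟨ cong (distances (2 + e) xs + T +_) total ⟨
  distances (2 + e) xs + T + (2 + e + sum xs)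
    ≡⟨ regroup (distances (2 + e) xs) T e (sum xs) ⟩
  distances (2 + e) xs + sum xs + (2 + e + T)
    ≡⟨ cong (_+ (2 + e + T)) (distances-max max) ⟩
  k * (2 + e) + (2 + e + T)                 ≡⟨ expand k e T ⟩
  2 * k + (k * e + (2 + e) + T)             ∎)
  where
  open ≡-Reasoning
  T : ℕ
  T = irregularity xs
  assemble : ∀ k d t r → 2 * k + (d + t + r) ≡ d + t + (2 * k + r)
  assemble = solve-∀
  regroup : ∀ d t e s → d + t + (2 + e + s) ≡ d + s + (2 + e + t)
  regroup = solve-∀
  expand : ∀ k e t → k * (2 + e) + (2 + e + t) ≡ 2 * k + (k * e + (2 + e) + t)
  expand = solve-∀

-- Lower bounds for nonincreasing positive lists of prescribed length and sum.

sum≤length*max : ∀ {a xs} → All (_≤ a) xs → sum xs ≤ length xs * a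
sum≤length*max []       = z≤n
sum≤length*max (p ∷ ps) = +-mono-≤ p (sum≤length*max ps)

-- The sum attains its upper bound, so no entry can fall short of `a`.
length*max≤sum⇒replicate : ∀ {a xs} → All (_≤ a) xs → length xs * a ≤ sum xs →
                           xs ≡ replicate (length xs) a
length*max≤sum⇒replicate {a} {[]}     []       _ = refl
length*max≤sum⇒replicate {a} {x ∷ xs} (p ∷ ps) q = cong₂ _∷_ x≡a
  (length*max≤sum⇒replicate ps
    (+-cancelˡ-≤ a _ _ (≤-trans q (+-monoˡ-≤ (sum xs) p))))
  where
  x≡a : x ≡ a
  x≡a = ≤-antisym p (+-cancelʳ-≤ (length xs * a) _ _
          (≤-trans q (+-monoʳ-≤ x (sum≤length*max ps))))

-- Rules out a head of 1 in the sorted lists below: `k + 1` entries of at most 1 sum to at most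
-- `k + 1`.
max≢1 : ∀ {k xs} → length xs ≡ suc k → All (_≤ 1) xs → ¬ 2 + 2 * k ≤ sum xs
max≢1 {k} {xs} len max q = <⇒≱ (m≤m+n (2 + k) k) (begin
  2 + k + k      ≡⟨ double k ⟩
  2 + 2 * k      ≤⟨ q ⟩
  sum xs         ≤⟨ sum≤length*max max ⟩
  length xs * 1  ≡⟨ trans (*-identityʳ _) len ⟩
  suc k          ∎)
  where
  open ≤-Reasoning
  double : ∀ k → 2 + k + k ≡ 2 + 2 * k
  double = solve-∀

-- The sum is one less than twice the length. Removing a leading 2 preserves this deficit and lowers
-- the irregularity by exactly 1, so induction runs down to the single entry 1. A head of 3 or more
-- exceeds the bound whatever the irregularity of the tail.
irregularity-deficit1 : ∀ k xs → length xs ≡ suc k → AllPairs _≥_ xs → All (1 ≤_) xs →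
                        sum xs ≡ 2 * k + 1 →
                        k ≤ irregularity xs ×
                        (irregularity xs ≡ k → xs ≡ replicate k 2 ++ 1 ∷ [])
irregularity-deficit1 zero (x ∷ []) refl _ _ total =
  z≤n , λ _ → cong (_∷ []) (trans (sym (+-identityʳ x)) total)
irregularity-deficit1 (suc k) (0 ∷ xs) _ _ (() ∷ _) _
irregularity-deficit1 (suc k) (1 ∷ xs) len (max ∷ _) _ total =
  contradiction (≤-reflexive (suc-injective (trans (shift k) (sym total)))) (max≢1 (suc-injective len) max)
  where
  shift : ∀ k → 1 + (2 + 2 * k) ≡ 2 * suc k + 1
  shift = solve-∀
irregularity-deficit1 (suc k) (2 ∷ xs) len (max ∷ sorted) (_ ∷ pos) total =
  subst (suc k ≤_) (sym S≡1+T) (s≤s (proj₁ ih)) ,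
  λ S≡1+k → cong (2 ∷_) (proj₂ ih (suc-injective (trans (sym S≡1+T) S≡1+k)))
  where
  shift : ∀ k → 2 * suc k + 1 ≡ 2 + (2 * k + 1)
  shift = solve-∀
  ih : k ≤ irregularity xs × (irregularity xs ≡ k → xs ≡ replicate k 2 ++ 1 ∷ [])
  ih = irregularity-deficit1 k xs (suc-injective len) sorted pos
         (+-cancelˡ-≡ 2 _ _ (trans total (shift k)))
  simplify : ∀ k t → suc k * 0 + 2 + t ≡ 1 + t + 1
  simplify = solve-∀
  S≡1+T : irregularity (2 ∷ xs) ≡ 1 + irregularity xs
  S≡1+T = +-cancelʳ-≡ 1 _ _ (trans (irregularity-peel (suc-injective len) max total)
            (simplify k (irregularity xs)))
irregularity-deficit1 (suc k) (suc (suc (suc e)) ∷ xs) len (max ∷ _) _ total =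
  <⇒≤ 1+k<S , λ S≡1+k → contradiction (sym S≡1+k) (<⇒≢ 1+k<S)
  where
  simplify : ∀ k e t → suc k * suc e + (2 + suc e) + t ≡
                       suc (suc k) + (suc k * e + (1 + e) + t) + 1
  simplify = solve-∀
  1+k<S : suc k < irregularity (3 + e ∷ xs)
  1+k<S = m+n≤o⇒m≤o (2 + k) (≤-reflexive (sym (+-cancelʳ-≡ 1 _ _
            (trans (irregularity-peel (suc-injective len) max total)
                   (simplify k e (irregularity xs))))))

-- The average is exactly 2, so a maximum of 2 forces a constant list. A maximum of 3 adds `2 + p`
-- and leaves a tail to which `irregularity-deficit1` applies, giving at least `p` more. A larger
-- maximum exceeds the bound strictly.
irregularity-deficit0 : ∀ p xs → length xs ≡ 2 + p → AllPairs _≥_ xs → All (1 ≤_) xs →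
                        sum xs ≡ 2 * (2 + p) →
                        xs ≡ replicate (2 + p) 2 ⊎
                        (2 * (1 + p) ≤ irregularity xs ×
                         (irregularity xs ≡ 2 * (1 + p) → xs ≡ 3 ∷ replicate p 2 ++ 1 ∷ []))
irregularity-deficit0 p (0 ∷ xs) _ _ (() ∷ _) _
irregularity-deficit0 p (1 ∷ xs) len (max ∷ _) _ total =
  contradiction (m+n≤o⇒m≤o (2 + 2 * p) (≤-reflexive (suc-injective (trans (shift p) (sym total)))))
    (max≢1 (suc-injective len) max)
  where
  shift : ∀ p → 1 + (2 + 2 * p + 1) ≡ 2 * (2 + p)
  shift = solve-∀
irregularity-deficit0 p (2 ∷ xs) len (max ∷ sorted) (_ ∷ pos) total =
  inj₁ (trans (length*max≤sum⇒replicate (≤-refl ∷ max)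
                (≤-reflexive (trans (cong (_* 2) len) (trans (*-comm (2 + p) 2) (sym total)))))
              (cong (λ l → replicate l 2) len))
irregularity-deficit0 p (3 ∷ xs) len (max ∷ sorted) (_ ∷ pos) total = inj₂
  ( ≤-trans (≤-reflexive (sym (shift₂ p))) (≤-trans (+-monoʳ-≤ (2 + p) (proj₁ tail)) (≤-reflexive (sym S≡)))
  , λ eq → cong (3 ∷_) (proj₂ tail (+-cancelˡ-≡ (2 + p) _ _
             (trans (sym S≡) (trans eq (sym (shift₂ p)))))))
  where
  shift₁ : ∀ p → 2 * (2 + p) ≡ 3 + (2 * p + 1)
  shift₁ = solve-∀
  shift₂ : ∀ p → 2 + p + p ≡ 2 * (1 + p)
  shift₂ = solve-∀
  -- Relative to the `1 + p` entries of the tail the total has excess 2, hence `r = 2` in the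
  -- peeling.
  shift₃ : ∀ p → 2 * (2 + p) ≡ 2 * suc p + 2
  shift₃ = solve-∀
  tail : p ≤ irregularity xs × (irregularity xs ≡ p → xs ≡ replicate p 2 ++ 1 ∷ [])
  tail = irregularity-deficit1 p xs (suc-injective len) sorted pos
           (+-cancelˡ-≡ 3 _ _ (trans total (shift₁ p)))
  simplify : ∀ p t → suc p * 1 + 3 + t ≡ 2 + p + t + 2
  simplify = solve-∀
  S≡ : irregularity (3 ∷ xs) ≡ 2 + p + irregularity xs
  S≡ = +-cancelʳ-≡ 2 _ _ (trans (irregularity-peel (suc-injective len) max (trans total (shift₃ p)))
         (simplify p (irregularity xs)))
irregularity-deficit0 p (suc (suc (suc (suc e))) ∷ xs) len (max ∷ sorted) (_ ∷ pos) total = inj₂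
  ( <⇒≤ bound , λ eq → contradiction (sym eq) (<⇒≢ bound))
  where
  shift₃ : ∀ p → 2 * (2 + p) ≡ 2 * suc p + 2
  shift₃ = solve-∀
  simplify : ∀ p e t → suc p * (2 + e) + (2 + (2 + e)) + t ≡
                       suc (2 * (1 + p)) + (suc p * e + (1 + e) + t) + 2
  simplify = solve-∀
  bound : 2 * (1 + p) < irregularity (4 + e ∷ xs)
  bound = m+n≤o⇒m≤o (suc (2 * (1 + p))) (≤-reflexive (sym (+-cancelʳ-≡ 2 _ _
            (trans (irregularity-peel (suc-injective len) max (trans total (shift₃ p)))
                   (simplify p e (irregularity xs))))))

-- With `n = 3 + p` the sum is `2 * n + 2`, and `4 * p + 6` is `4 * n - 6`. Sorting brings an entry
-- of at least 4 to the head; of the possible heads 4, 5 and at least 6, only 4 allows equality.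
irregularity-excess2 : ∀ p xs → length xs ≡ 3 + p → AllPairs _≥_ xs → All (1 ≤_) xs →
                       Any (4 ≤_) xs → sum xs ≡ 2 * (3 + p) + 2 →
                       xs ≡ 4 ∷ replicate (2 + p) 2 ⊎
                       (4 * p + 6 ≤ irregularity xs ×
                        (irregularity xs ≡ 4 * p + 6 → xs ≡ 4 ∷ 3 ∷ replicate p 2 ++ 1 ∷ []))
irregularity-excess2 p (a ∷ xs) len (max ∷ sorted) (_ ∷ pos) large total = go a refl (head large)
  where
  head : Any (4 ≤_) (a ∷ xs) → 4 ≤ a
  head (here 4≤a) = 4≤a
  head (there q)  = All.lookupWith (λ x≤a 4≤x → ≤-trans 4≤x x≤a) max q

  total′ : a + sum xs ≡ 2 * (2 + p) + 4
  total′ = trans total (shift p)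
    where
    shift : ∀ p → 2 * (3 + p) + 2 ≡ 2 * (2 + p) + 4
    shift = solve-∀

  T : ℕ
  T = irregularity xs

  peel : ∀ e → a ≡ 4 + e → irregularity (a ∷ xs) ≡ (2 + p) * (2 + e) + e + T
  peel e refl = +-cancelʳ-≡ 4 _ _ (trans (irregularity-peel (suc-injective len) max total′)
                  (regroup p e T))
    where
    regroup : ∀ p e t → (2 + p) * (2 + e) + (4 + e) + t ≡ (2 + p) * (2 + e) + e + t + 4
    regroup = solve-∀

  exceeds : 4 * p + 6 < irregularity (a ∷ xs) →
           4 * p + 6 ≤ irregularity (a ∷ xs) ×
           (irregularity (a ∷ xs) ≡ 4 * p + 6 → a ∷ xs ≡ 4 ∷ 3 ∷ replicate p 2 ++ 1 ∷ [])
  exceeds q = <⇒≤ q , λ eq → contradiction (sym eq) (<⇒≢ q)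

  -- The head is matched through a copy `b`, so that `total′` and `peel`, stated for `a`, serve
  -- every case.
  go : ∀ b → a ≡ b → 4 ≤ b →
       a ∷ xs ≡ 4 ∷ replicate (2 + p) 2 ⊎
       (4 * p + 6 ≤ irregularity (a ∷ xs) ×
        (irregularity (a ∷ xs) ≡ 4 * p + 6 → a ∷ xs ≡ 4 ∷ 3 ∷ replicate p 2 ++ 1 ∷ []))
  go 4 refl (s≤s (s≤s (s≤s (s≤s z≤n))))
    with irregularity-deficit0 p xs (suc-injective len) sorted pos
           (+-cancelˡ-≡ 4 _ _ (trans total′ (+-comm _ 4)))
  ... | inj₁ xs≡2s = inj₁ (cong (4 ∷_) xs≡2s)
  ... | inj₂ (bound , extremal) = inj₂
    ( ≤-trans (≤-reflexive (sym (split p))) (≤-trans (+-monoʳ-≤ ((2 + p) * 2 + 0) bound)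
        (≤-reflexive (sym (peel 0 refl))))
    , λ eq → cong (4 ∷_) (extremal (+-cancelˡ-≡ ((2 + p) * 2 + 0) _ _
               (trans (sym (peel 0 refl)) (trans eq (sym (split p)))))))
    where
    split : ∀ p → (2 + p) * 2 + 0 + 2 * (1 + p) ≡ 4 * p + 6
    split = solve-∀
  -- The head contributes `3 * p + 7`, too little once `p ≥ 1`. The tail has sum one below twice its
  -- length and supplies another `1 + p`.
  go 5 refl (s≤s (s≤s (s≤s (s≤s z≤n)))) = inj₂ (exceeds (begin-strict
    4 * p + 6                <⟨ m<m+n (4 * p + 6) z<s ⟩
    4 * p + 6 + 2            ≡⟨ split p ⟩
    (2 + p) * 3 + 1 + (1 + p) ≤⟨ +-monoʳ-≤ ((2 + p) * 3 + 1) (proj₁ tail) ⟩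
    (2 + p) * 3 + 1 + T      ≡⟨ peel 1 refl ⟨
    irregularity (5 ∷ xs)    ∎))
    where
    open ≤-Reasoning
    split : ∀ p → 4 * p + 6 + 2 ≡ (2 + p) * 3 + 1 + (1 + p)
    split = solve-∀
    shift : ∀ p → 2 * (2 + p) + 4 ≡ 5 + (2 * (1 + p) + 1)
    shift = solve-∀
    tail : 1 + p ≤ T × (T ≡ 1 + p → xs ≡ replicate (1 + p) 2 ++ 1 ∷ [])
    tail = irregularity-deficit1 (1 + p) xs (suc-injective len) sorted pos
             (+-cancelˡ-≡ 5 _ _ (trans total′ (shift p)))
  -- From 6 on, the head alone contributes at least `4 * p + 10`.
  go (suc (suc (suc (suc (suc (suc e)))))) refl (s≤s (s≤s (s≤s (s≤s z≤n)))) =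
    inj₂ (exceeds (m+n≤o⇒m≤o (suc (4 * p + 6)) (≤-reflexive (sym
      (trans (peel (2 + e) refl) (split p e T))))))
    where
    split : ∀ p e t → (2 + p) * (2 + (2 + e)) + (2 + e) + t ≡
                      suc (4 * p + 6) + ((2 + p) * e + (3 + e) + t)
    split = solve-∀

-- Irregularity of the two extremal lists.

distances-replicate : ∀ a k b ys → distances a (replicate k b ++ ys) ≡ k * ∣ a - b ∣ + distances a ys
distances-replicate a zero    b ys = refl
distances-replicate a (suc k) b ys =
  trans (cong (∣ a - b ∣ +_) (distances-replicate a k b ys)) (sym (+-assoc ∣ a - b ∣ _ _))

-- Copies of `b` are at distance 0 from each other, so each contributes only its distances to `ys`.
irregularity-replicate : ∀ k b ys →
  irregularity (replicate k b ++ ys) ≡ k * distances b ys + irregularity ys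
irregularity-replicate zero    b ys = refl
irregularity-replicate (suc k) b ys = begin
  distances b (replicate k b ++ ys) + irregularity (replicate k b ++ ys)
    ≡⟨ cong₂ _+_ (distances-replicate b k b ys) (irregularity-replicate k b ys) ⟩
  k * ∣ b - b ∣ + distances b ys + (k * distances b ys + irregularity ys)
    ≡⟨ cong (λ d → k * d + distances b ys + (k * distances b ys + irregularity ys)) (∣n-n∣≡0 b) ⟩
  k * 0 + distances b ys + (k * distances b ys + irregularity ys)
    ≡⟨ collect k (distances b ys) (irregularity ys) ⟩
  suc k * distances b ys + irregularity ys ∎
  where
  open ≡-Reasoning
  collect : ∀ k d t → k * 0 + d + (k * d + t) ≡ suc k * d + t
  collect = solve-∀

irregularity-4-2s : ∀ k → irregularity (4 ∷ replicate k 2) ≡ 2 * k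
irregularity-4-2s k rewrite sym (++-identityʳ (replicate k 2))
  | distances-replicate 4 k 2 [] | irregularity-replicate k 2 [] = collect k
  where
  collect : ∀ k → k * 2 + 0 + (k * 0 + 0) ≡ 2 * k
  collect = solve-∀

irregularity-4-3-2s-1 : ∀ k → irregularity (4 ∷ 3 ∷ replicate k 2 ++ 1 ∷ []) ≡ 4 * k + 6
irregularity-4-3-2s-1 k rewrite distances-replicate 4 k 2 (1 ∷ [])
  | distances-replicate 3 k 2 (1 ∷ []) | irregularity-replicate k 2 (1 ∷ []) = collect k
  where
  collect : ∀ k → 1 + (k * 2 + 3) + (k * 1 + 2 + (k * 1 + 0)) ≡ 4 * k + 6
  collect = solve-∀

-- From double sums over vertices to lists.

sum-tabulate : ∀ n (f : Fin n → ℕ) → sum (tabulate f) ≡ ∑[ i < n ] f i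
sum-tabulate zero    f = refl
sum-tabulate (suc n) f = cong (f zero +_) (sum-tabulate n (f ∘ suc))

-- Split off the first index: the diagonal term is 0, and by symmetry the first row and column have
-- the same sum `a`.
∑∑∣-∣≡2*irregularity : ∀ n (f : Fin n → ℕ) →
  (∑[ x < n ] ∑[ y < n ] ∣ f x - f y ∣) ≡ 2 * irregularity (tabulate f)
∑∑∣-∣≡2*irregularity zero    f = refl
∑∑∣-∣≡2*irregularity (suc n) f = begin
  ∣ f zero - f zero ∣ + a + (∑[ x < n ] (∣ f (suc x) - f zero ∣ + ∑[ y < n ] ∣ f (suc x) - f (suc y) ∣))
    ≡⟨ cong₂ _+_ (cong (_+ a) (∣n-n∣≡0 (f zero)))
         (∑-distrib-+ (λ x → ∣ f (suc x) - f zero ∣) (λ x → ∑[ y < n ] ∣ f (suc x) - f (suc y) ∣)) ⟩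
  a + ((∑[ x < n ] ∣ f (suc x) - f zero ∣) + (∑[ x < n ] ∑[ y < n ] ∣ f (suc x) - f (suc y) ∣))
    ≡⟨ cong (a +_) (cong₂ _+_ (sum-cong-≗ (λ x → ∣-∣-comm (f (suc x)) (f zero)))
         (∑∑∣-∣≡2*irregularity n (f ∘ suc))) ⟩
  a + (a + 2 * t)
    ≡⟨ collect a t ⟩
  2 * (a + t)
    ≡⟨ cong (λ d → 2 * (d + t)) a≡distances ⟩
  2 * (distances (f zero) (tabulate (f ∘ suc)) + t) ∎
  where
  open ≡-Reasoning
  a t : ℕ
  a = ∑[ y < n ] ∣ f zero - f (suc y) ∣
  t = irregularity (tabulate (f ∘ suc))
  a≡distances : a ≡ distances (f zero) (tabulate (f ∘ suc))
  a≡distances = trans (sym (sum-tabulate n _))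
    (cong sum (sym (map-tabulate (f ∘ suc) (λ x → ∣ f zero - x ∣))))
  collect : ∀ a t → a + (a + 2 * t) ≡ 2 * (a + t)
  collect = solve-∀

-- Counting with indicators.

indicator : ∀ {P : Set} → Dec P → ℕ
indicator P? = if does P? then 1 else 0

-- Meant for `A`, `B` as adjacency in the two directions and `P`, `Q` as the two strict orders of
-- the endpoints. The decisions `A?` and `B?` are separate terms although `A` and `B` are
-- equivalent, hence the case analysis.
indicator-split : ∀ {A B P Q : Set} (A? : Dec A) (B? : Dec B) (P? : Dec P) (Q? : Dec Q) →
  (A → B) → (B → A) → (P → ¬ Q) → (A → P ⊎ Q) →
  indicator A? ≡ indicator (P? ×-dec A?) + indicator (Q? ×-dec B?)
indicator-split (yes a) (no ¬b) _       _       A→B _   _    _   = contradiction (A→B a) ¬b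
indicator-split (no ¬a) (yes b) _       _       _   B→A _    _   = contradiction (B→A b) ¬a
indicator-split (no _)  (no _)  (yes _) (yes _) _   _   _    _   = refl
indicator-split (no _)  (no _)  (yes _) (no _)  _   _   _    _   = refl
indicator-split (no _)  (no _)  (no _)  (yes _) _   _   _    _   = refl
indicator-split (no _)  (no _)  (no _)  (no _)  _   _   _    _   = refl
indicator-split (yes _) (yes _) (yes p) (yes q) _   _   P→¬Q _   = contradiction q (P→¬Q p)
indicator-split (yes _) (yes _) (yes _) (no _)  _   _   _    _   = refl
indicator-split (yes _) (yes _) (no _)  (yes _) _   _   _    _   = refl
indicator-split (yes a) (yes _) (no ¬p) (no ¬q) _   _   _    A→P⊎Q with A→P⊎Q a
... | inj₁ p = contradiction p ¬p
... | inj₂ q = contradiction q ¬q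

module _ {A : Set} {P : A → Set} (P? : Decidable P) where

  length-filter-tabulate : ∀ n (f : Fin n → A) →
    length (filter P? (tabulate f)) ≡ ∑[ i < n ] indicator (P? (f i))
  length-filter-tabulate zero    f = refl
  length-filter-tabulate (suc n) f with ih ← length-filter-tabulate n (f ∘ suc) | P? (f zero)
  ... | yes _ = cong suc ih
  ... | no  _ = ih

length-filter-cartesianProduct :
  ∀ {A B : Set} {P : A × B → Set} (P? : Decidable P) m n (f : Fin m → A) (g : Fin n → B) →
  length (filter P? (cartesianProduct (tabulate f) (tabulate g))) ≡
  ∑[ i < m ] ∑[ j < n ] indicator (P? (f i , g j))
length-filter-cartesianProduct P? zero    n f g = refl
length-filter-cartesianProduct P? (suc m) n f g = begin
  length (filter P? (row ++ rest))                    ≡⟨ cong length (filter-++ P? row rest) ⟩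
  length (filter P? row ++ filter P? rest)            ≡⟨ length-++ (filter P? row) ⟩
  length (filter P? row) + length (filter P? rest)
    ≡⟨ cong₂ _+_
         (trans (cong (length ∘ filter P?) (map-tabulate g (f zero ,_)))
                (length-filter-tabulate P? n (λ j → f zero , g j)))
         (length-filter-cartesianProduct P? m n (f ∘ suc) g) ⟩
  _ ∎
  where
  open ≡-Reasoning
  row  = map (f zero ,_) (tabulate g)
  rest = cartesianProduct (tabulate (f ∘ suc)) (tabulate g)

-- Pigeonhole: the position of `g i` in the filtered list determines `g i`, hence `i`.
injective⇒≤length-filter : ∀ {n k} {P : Fin n → Set} (P? : Decidable P) {g : Fin k → Fin n} →
  Injective _≡_ _≡_ g → (∀ i → P (g i)) → k ≤ length (filter P? (allFin n))
injective⇒≤length-filter {n} {k} P? {g} g-inj Pg = injective⇒≤ index-inj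
  where
  member = λ i → ∈-filter⁺ P? (∈-allFin (g i)) (Pg i)
  index-inj : Injective _≡_ _≡_ (Any.index ∘ member)
  index-inj {i} {j} eq = g-inj (trans (Any.lookup-index (member i))
    (trans (cong (lookup (filter P? (allFin n))) eq) (sym (Any.lookup-index (member j)))))

-- Neighbours in the cyclic order.

module _ {k : ℕ} where

  cyclicSucc : (i : Fin k) → ∃ (CyclicSucc i)
  cyclicSucc i with m≤n⇒m<n∨m≡n (toℕ<n i)
  ... | inj₁ 1+i<k = fromℕ< 1+i<k , inj₁ (toℕ-fromℕ< 1+i<k)
  ... | inj₂ 1+i≡k = fromℕ< 0<k , inj₂ (1+i≡k , toℕ-fromℕ< 0<k)
    where
    0<k : 0 < k
    0<k = ≤-trans z<s (toℕ<n i)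

  cyclicPred : (i : Fin k) → ∃ λ h → CyclicSucc h i
  cyclicPred i with toℕ i | toℕ<n i
  ... | suc h | 1+h<k = fromℕ< (<⇒≤ 1+h<k) , inj₁ (cong suc (sym (toℕ-fromℕ< _)))
  ... | zero  | s≤s {n = k-1} _ = fromℕ< (n<1+n k-1) , inj₂ (cong suc (toℕ-fromℕ< _) , refl)

  -- Two upward steps cannot return to the start, and a wraparound would force `k ≤ 2`. This keeps
  -- the two neighbours on a cycle distinct.
  CyclicSucc-asym : k ≥ 3 → ∀ {i j : Fin k} → CyclicSucc i j → ¬ CyclicSucc j i
  CyclicSucc-asym k≥3 {i} {j} p q with toℕ i | toℕ j
  CyclicSucc-asym k≥3 (inj₁ refl)          (inj₁ ())            | _ | _
  CyclicSucc-asym (s≤s (s≤s ())) (inj₁ refl) (inj₂ (refl , refl)) | _ | _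
  CyclicSucc-asym (s≤s (s≤s ())) (inj₂ (refl , refl)) (inj₁ refl) | _ | _

-- Degrees in the graph.

module _ {n : ℕ} (G : Graph n) where
  open Graph G

  -- Built from the decision by which `edges` filters, so its double sum counts the edges.
  forward : Fin n → Fin n → ℕ
  forward x y = indicator ((x <? y) ×-dec adj? x y)

  indicator-adj : ∀ x y → indicator (adj? x y) ≡ forward x y + forward y x
  indicator-adj x y = indicator-split (adj? x y) (adj? y x) (x <? y) (y <? x) symm symm <-asym ordered
    where
    ordered : Adj x y → x Fin.< y ⊎ y Fin.< x
    ordered a with <-cmp x y
    ... | tri< x<y _ _ = inj₁ x<y
    ... | tri≈ _ x≡y _ = contradiction a (irrefl x≡y)
    ... | tri> _ _ y<x = inj₂ y<x

  -- Adjacency splits into an upward and a downward part; interchanging the summations turns the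
  -- second into the first.
  handshake : sum (tabulate (degree G)) ≡ 2 * length (edges G)
  handshake = begin
    sum (tabulate (degree G))
      ≡⟨ sum-tabulate n (degree G) ⟩
    ∑[ x < n ] degree G x
      ≡⟨ sum-cong-≗ (λ x → length-filter-tabulate (adj? x) n id) ⟩
    ∑[ x < n ] ∑[ y < n ] indicator (adj? x y)
      ≡⟨ sum-cong-≗ (λ x → trans (sum-cong-≗ (indicator-adj x))
           (∑-distrib-+ (forward x) (λ y → forward y x))) ⟩
    ∑[ x < n ] ((∑[ y < n ] forward x y) + (∑[ y < n ] forward y x))
      ≡⟨ ∑-distrib-+ (λ x → ∑[ y < n ] forward x y) (λ x → ∑[ y < n ] forward y x) ⟩
    E + (∑[ x < n ] ∑[ y < n ] forward y x)
      ≡⟨ cong (E +_) (∑-comm (λ x y → forward y x)) ⟩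
    E + E
      ≡⟨ cong (E +_) (+-identityʳ E) ⟨
    2 * E
      ≡⟨ cong (2 *_) (length-filter-cartesianProduct _ n n id id) ⟨
    2 * length (edges G) ∎
    where
    open ≡-Reasoning
    E : ℕ
    E = ∑[ x < n ] ∑[ y < n ] forward x y

  -- The halving in `irrₜ` is exact, so a factor 2 cancels; sorting is then covered by permutation
  -- invariance.
  irrₜ≡irregularity : irrₜ G ≡ irregularity (degreeSequence G)
  irrₜ≡irregularity = trans
    (*-cancelˡ-≡ (irrₜ G) (irregularity (tabulate (degree G))) 2
      (trans (2*irrₜ≡irrSum G) (∑∑∣-∣≡2*irregularity n (degree G))))
    (irregularity-↭ (↭-sym (sort-↭ (tabulate (degree G)))))

  injective⇒≤degree : ∀ {k v} {g : Fin k → Fin n} → Injective _≡_ _≡_ g →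
                      (∀ i → Adj v (g i)) → k ≤ degree G v
  injective⇒≤degree {v = v} = injective⇒≤length-filter (adj? v)

  connected⇒degree≥1 : Connected G → ∀ {v w} → v ≢ w → 1 ≤ degree G v
  connected⇒degree≥1 conn {v} {w} v≢w with conn v w
  ... | ε               = contradiction refl v≢w
  ... | _◅_ {j = u} a _ = injective⇒≤degree {g = λ _ → u} (λ { {zero} {zero} _ → refl }) (λ _ → a)

  -- Successor and predecessor along the cycle serve; were they equal, `CyclicSucc-asym` would fail.
  cycle-neighbours : (C : Cycle G) → ∀ {v} → v ∈ᶜ C →
    ∃ λ u → ∃ λ w → u ∈ᶜ C × w ∈ᶜ C × u ≢ w × Adj v u × Adj v w
  cycle-neighbours C (i , refl) with cyclicSucc i | cyclicPred i
  ... | j , i→j | h , h→i = vertex j , vertex h , (j , refl) , (h , refl) ,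
    (λ eq → CyclicSucc-asym size≥3 i→j (subst (λ l → CyclicSucc l i) (sym (injective eq)) h→i)) ,
    adjacent i→j , symm (adjacent h→i)
    where open Cycle C

  four-neighbours : ∀ {v a b c d} → Adj v a → Adj v b → Adj v c → Adj v d →
    a ≢ b → a ≢ c → a ≢ d → b ≢ c → b ≢ d → c ≢ d → 4 ≤ degree G v
  four-neighbours {v} {a} {b} {c} {d} va vb vc vd a≢b a≢c a≢d b≢c b≢d c≢d =
    injective⇒≤degree {g = g} g-inj adj
    where
    g : Fin 4 → Fin n
    g zero                   = a
    g (suc zero)             = b
    g (suc (suc zero))       = c
    g (suc (suc (suc zero))) = d
    adj : ∀ i → Adj v (g i)
    adj zero                   = va
    adj (suc zero)             = vb
    adj (suc (suc zero))       = vc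
    adj (suc (suc (suc zero))) = vd
    g-inj : Injective _≡_ _≡_ g
    g-inj {zero} {zero} _ = refl
    g-inj {zero} {suc zero} e = contradiction e a≢b
    g-inj {zero} {suc (suc zero)} e = contradiction e a≢c
    g-inj {zero} {suc (suc (suc zero))} e = contradiction e a≢d
    g-inj {suc zero} {zero} e = contradiction (sym e) a≢b
    g-inj {suc zero} {suc zero} _ = refl
    g-inj {suc zero} {suc (suc zero)} e = contradiction e b≢c
    g-inj {suc zero} {suc (suc (suc zero))} e = contradiction e b≢d
    g-inj {suc (suc zero)} {zero} e = contradiction (sym e) a≢c
    g-inj {suc (suc zero)} {suc zero} e = contradiction (sym e) b≢c
    g-inj {suc (suc zero)} {suc (suc zero)} _ = refl
    g-inj {suc (suc zero)} {suc (suc (suc zero))} e = contradiction e c≢d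
    g-inj {suc (suc (suc zero))} {zero} e = contradiction (sym e) a≢d
    g-inj {suc (suc (suc zero))} {suc zero} e = contradiction (sym e) b≢d
    g-inj {suc (suc (suc zero))} {suc (suc zero)} e = contradiction (sym e) c≢d
    g-inj {suc (suc (suc zero))} {suc (suc (suc zero))} _ = refl

  -- Each cycle provides two neighbours of `v`. One lying on both cycles would be `v` itself, which
  -- is not adjacent to itself.
  common-vertex-degree : (C D : Cycle G) → ∀ {v} → v ∈ᶜ C → v ∈ᶜ D →
    (∀ {u} → u ∈ᶜ C × u ∈ᶜ D → v ≡ u) → 4 ≤ degree G v
  common-vertex-degree C D {v} v∈C v∈D unique =
    let a , b , a∈C , b∈C , a≢b , va , vb = cycle-neighbours C v∈C
        c , d , c∈D , d∈D , c≢d , vc , vd = cycle-neighbours D v∈D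
    in four-neighbours va vb vc vd a≢b (apart a∈C c∈D va) (apart a∈C d∈D va)
         (apart b∈C c∈D vb) (apart b∈C d∈D vb) c≢d
    where
    apart : ∀ {x y} → x ∈ᶜ C → y ∈ᶜ D → Adj v x → x ≢ y
    apart x∈C x∈D vx refl = irrefl (unique (x∈C , x∈D)) vx

-- Assembling the bounds and the equality cases.

distinct-vertex : ∀ {n} (v : Fin (2 + n)) → ∃ λ w → v ≢ w
distinct-vertex zero    = suc zero , λ ()
distinct-vertex (suc _) = zero , λ ()

2*n∸2 : ∀ p → 2 * (3 + p) ∸ 2 ≡ 2 * (2 + p)
2*n∸2 p = cong (_∸ 2) (shift p)
  where
  shift : ∀ p → 2 * (3 + p) ≡ 2 + 2 * (2 + p)
  shift = solve-∀

4*n∸6 : ∀ p → 4 * (3 + p) ∸ 6 ≡ 4 * p + 6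
4*n∸6 p = cong (_∸ 6) (shift p)
  where
  shift : ∀ p → 4 * (3 + p) ≡ 6 + (4 * p + 6)
  shift = solve-∀

-- `I`, `b₁` and `b₂` are variables so that matching on `refl` eliminates `irrₜ` and the truncated
-- subtractions.
dichotomy⇒bounds : ∀ p {I b₁ b₂ xs} → I ≡ irregularity xs → b₁ ≡ 2 * (2 + p) → b₂ ≡ 4 * p + 6 →
  xs ≡ 4 ∷ replicate (2 + p) 2 ⊎
  (4 * p + 6 ≤ irregularity xs ×
   (irregularity xs ≡ 4 * p + 6 → xs ≡ 4 ∷ 3 ∷ replicate p 2 ++ 1 ∷ [])) →
  (I ≥ b₁ × (I ≡ b₁ ⇔ xs ≡ 4 ∷ replicate (2 + p) 2)) ×
  (¬ (xs ≡ 4 ∷ replicate (2 + p) 2) →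
   I ≥ b₂ × (I ≡ b₂ ⇔ xs ≡ 4 ∷ 3 ∷ replicate p 2 ++ 1 ∷ []))
dichotomy⇒bounds p {xs = xs} refl refl refl cases = part₁ cases , part₂ cases
  where
  Case₁ Case₂ : Set
  Case₁ = xs ≡ 4 ∷ replicate (2 + p) 2
  Case₂ = xs ≡ 4 ∷ 3 ∷ replicate p 2 ++ 1 ∷ []
  Dichotomy : Set
  Dichotomy = Case₁ ⊎ (4 * p + 6 ≤ irregularity xs × (irregularity xs ≡ 4 * p + 6 → Case₂))
  value₁ : Case₁ → irregularity xs ≡ 2 * (2 + p)
  value₁ eq = trans (cong irregularity eq) (irregularity-4-2s (2 + p))
  value₂ : Case₂ → irregularity xs ≡ 4 * p + 6
  value₂ eq = trans (cong irregularity eq) (irregularity-4-3-2s-1 p)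
  -- This gap keeps lists of the second alternative from attaining the first bound.
  bound₁<bound₂ : 2 * (2 + p) < 4 * p + 6
  bound₁<bound₂ = m+n≤o⇒m≤o (suc (2 * (2 + p))) (≤-reflexive (split p))
    where
    split : ∀ p → suc (2 * (2 + p)) + (2 * p + 1) ≡ 4 * p + 6
    split = solve-∀
  part₁ : Dichotomy → irregularity xs ≥ 2 * (2 + p) × (irregularity xs ≡ 2 * (2 + p) ⇔ Case₁)
  part₁ (inj₁ eq)          = ≤-reflexive (sym (value₁ eq)) , mk⇔ (λ _ → eq) value₁
  part₁ (inj₂ (bound , _)) = <⇒≤ large , mk⇔ (λ eq → contradiction (sym eq) (<⇒≢ large)) value₁
    where
    large : 2 * (2 + p) < irregularity xs
    large = <-≤-trans bound₁<bound₂ bound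
  part₂ : Dichotomy → ¬ Case₁ →
          irregularity xs ≥ 4 * p + 6 × (irregularity xs ≡ 4 * p + 6 ⇔ Case₂)
  part₂ (inj₁ eq)                 ¬case₁ = contradiction eq ¬case₁
  part₂ (inj₂ (bound , extremal)) _      = bound , mk⇔ extremal value₂

theorem12 : (n : ℕ) → n ≥ 6 → (G : Graph n) → B⁺ G →
    ( irrₜ G ≥ 2 * n ∸ 2
    × (irrₜ G ≡ 2 * n ∸ 2 ⇔ degreeSequence G ≡ 4 ∷ replicate (n ∸ 1) 2) )
    ×
    ( ¬ (degreeSequence G ≡ 4 ∷ replicate (n ∸ 1) 2) →
    irrₜ G ≥ 4 * n ∸ 6
    × (irrₜ G ≡ 4 * n ∸ 6 ⇔ degreeSequence G ≡ 4 ∷ 3 ∷ replicate (n ∸ 3) 2 ++ (1 ∷ [])) )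
-- With `n` as `3 + p`, `n ∸ 1` and `n ∸ 3` compute to `2 + p` and `p`.
theorem12 (suc (suc (suc p))) (s≤s (s≤s (s≤s _))) G ((conn , size) , C , D , v , (v∈C , v∈D) , unique) =
  dichotomy⇒bounds p (irrₜ≡irregularity G) (2*n∸2 p) (4*n∸6 p) (irregularity-excess2 p (degreeSequence G)
    (trans (↭-length perm) (length-tabulate (degree G)))
    (Linked⇒AllPairs (λ x≥y y≥z → ≤-trans y≥z x≥y) (sort-↗ degrees))
    (All-resp-↭ (↭-sym perm) (All.tabulate⁺ {f = degree G}
      (λ u → connected⇒degree≥1 G conn (proj₂ (distinct-vertex u)))))
    (Any-resp-↭ (↭-sym perm) (Any.tabulate⁺ {f = degree G} v
      (common-vertex-degree G C D v∈C v∈D unique)))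
    (trans (sum-↭ perm) (trans (handshake G) (trans (cong (2 *_) size) (*-distribˡ-+ 2 (3 + p) 1)))))
  where
  degrees : List ℕ
  degrees = tabulate (degree G)
  perm : degreeSequence G ↭ degrees
  perm = sort-↭ degrees
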